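{- For every extreme point $(x,y,z)$ of the polyhedron GVC-LP, the vector $x$ is half-integral, i.e. $x_i\in\{0,\tfrac12,1\}$ for all $i\in V$.
   Context: Let $G=(V,E)$ be a graph. GVC-LP is the linear programming relaxation of the following mixed integer formulation of the generalized vertex cover problem (objective: minimize $\sum_{i\in V}c_ix_i+\sum_{(i,j)\in E}(q^2_{ij}-q^1_{ij})y_{ij}+\sum_{(i,j)\in E}(q^0_{ij}-q^1_{ij})z_{ij}$), with variables $x_i$ ($i\in V$), $y_{ij},z_{ij}$ ($(i,j)\in E$) and constraints: $x_i+x_j\le 1+y_{ij}$, $x_i\ge y_{ij}$, $x_j\ge y_{ij}$, $z_{ij}=1-x_i-x_j+y_{ij}$, $y_{ij}\ge 0$ for all $(i,j)\in E$, and $x_i\in\{0,1\}$, $z_{ij}\in\{0,1\}$. In GVC-LP the integrality constraints are replaced by $0\le x_i\le 1$ and $0\le z_{ij}\le 1$. Extreme points refer to the feasible region of GVC-LP. -}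

module Defs where

open import Algebra.Apartness.Bundles using (HeytingField; HeytingCommutativeRing)
open import Algebra.Bundles using (CommutativeRing)
open import Data.Fin.Base using (Fin)
import Data.Fin.Base as Fin
open import Data.Nat.Base using (ℕ)
open import Data.Product.Base using (_×_; _,_; proj₁; proj₂)
import Data.Rational.Base as ℚ
import Data.Rational.Properties as ℚ
open import Data.Sum.Base using (_⊎_; inj₁; inj₂)
open import Level using (Level; 0ℓ; suc; _⊔_)
open import Relation.Binary.Core using (Rel)
open import Relation.Binary.Definitions using (tri<; tri≈; tri>)
open import Relation.Binary.PropositionalEquality.Core using (_≡_; _≢_; ≢-sym; subst)
open import Relation.Binary.Structures using (IsStrictPartialOrder)
open import Relation.Nullary.Negation using (¬_; contradiction)

-- The order is cotransitive (because _#_ is) but not assumed decidable, so that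
-- the models include ℚ and both the classical and the constructive reals.
record OrderedField (c ℓ₁ ℓ₂ ℓ₃ : Level) : Set (suc (c ⊔ ℓ₁ ⊔ ℓ₂ ⊔ ℓ₃)) where
  infix 4 _<_ _≤_
  field
    heytingField : HeytingField c ℓ₁ ℓ₂

  open HeytingField heytingField public

  field
    _<_                  : Rel Carrier ℓ₃
    isStrictPartialOrder : IsStrictPartialOrder _≈_ _<_
    #⇒<∨>                : ∀ {a b} → a # b → a < b ⊎ b < a
    <⇒#                  : ∀ {a b} → a < b → a # b
    +-monoʳ-<            : ∀ a {b d} → b < d → a + b < a + d
    *-pos                : ∀ {a b} → 0# < a → 0# < b → 0# < a * b

  open IsStrictPartialOrder isStrictPartialOrder public
    using (<-respʳ-≈; <-respˡ-≈; <-resp-≈)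
    renaming (irrefl to <-irrefl; trans to <-trans; asym to <-asym)

  _≤_ : Rel Carrier ℓ₃
  a ≤ b = ¬ (b < a)

  open HeytingCommutativeRing heytingCommutativeRing public using (commutativeRing)
  open CommutativeRing commutativeRing public using (ring)
  open import Algebra.Properties.Ring ring using (-0#≈0#; -1*x≈-x; -‿involutive)

  a-0≈a : ∀ a → a - 0# ≈ a
  a-0≈a a = trans (+-congˡ -0#≈0#) (+-identityʳ a)

  1#0 : 1# # 0#
  1#0 = invertible⇒# (1# , trans (*-identityˡ _) (a-0≈a 1#) , trans (*-identityʳ _) (a-0≈a 1#))

  0<1 : 0# < 1#
  0<1 with #⇒<∨> 1#0
  ... | inj₂ 0<1 = 0<1
  ... | inj₁ 1<0 = <-respʳ-≈ (trans (-1*x≈-x _) (-‿involutive 1#)) (*-pos 0<-1 0<-1)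
    where
    0<-1 : 0# < - 1#
    0<-1 = <-respˡ-≈ (-‿inverseˡ 1#) (<-respʳ-≈ (+-identityʳ _) (+-monoʳ-< (- 1#) 1<0))

  2# : Carrier
  2# = 1# + 1#

  2##0 : 2# # 0#
  2##0 = #-sym (<⇒# (<-trans 0<1 (<-respˡ-≈ (+-identityʳ 1#) (+-monoʳ-< 1# 0<1))))

  -- Formally the inverse of 2# - 0#, the form in which HeytingField supplies
  -- inverses; 2*½≈1 shows that it is the inverse of 2#.
  ½ : Carrier
  ½ = proj₁ (#⇒invertible 2##0)

  2*½≈1 : 2# * ½ ≈ 1#
  2*½≈1 = trans (*-congʳ (sym (a-0≈a 2#))) (proj₂ (proj₂ (#⇒invertible 2##0)))

ℚ-orderedField : OrderedField 0ℓ 0ℓ 0ℓ 0ℓ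
ℚ-orderedField = record
  { heytingField         = ℚ.heytingField
  ; _<_                  = ℚ._<_
  ; isStrictPartialOrder = ℚ.<-isStrictPartialOrder
  ; #⇒<∨>                = #⇒<∨>
  ; <⇒#                  = ℚ.<⇒≢
  ; +-monoʳ-<            = λ a → ℚ.+-monoʳ-< a
  ; *-pos                = *-pos
  }
  where
  #⇒<∨> : ∀ {a b} → a ≢ b → a ℚ.< b ⊎ b ℚ.< a
  #⇒<∨> {a} {b} a≢b with ℚ.<-cmp a b
  ... | tri< a<b _ _ = inj₁ a<b
  ... | tri≈ _ a≡b _ = contradiction a≡b a≢b
  ... | tri> _ _ b<a = inj₂ b<a

  *-pos : ∀ {a b} → ℚ.0ℚ ℚ.< a → ℚ.0ℚ ℚ.< b → ℚ.0ℚ ℚ.< a ℚ.* b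
  *-pos {a} {b} 0<a 0<b =
    subst (ℚ._< a ℚ.* b) (ℚ.*-zeroʳ a)
      (ℚ.*-monoʳ-<-pos a {{ℚ.positive 0<a}} 0<b)

-- A finite simple undirected graph: each edge {i , j} is listed once, as the
-- pair of its endpoints in increasing order.
record Graph : Set where
  field
    ∣V∣ ∣E∣ : ℕ

  V : Set
  V = Fin ∣V∣

  E : Set
  E = Fin ∣E∣

  field
    src tgt : E → V
    src<tgt : ∀ e → src e Fin.< tgt e
    simple  : ∀ {e f} → src e ≡ src f → tgt e ≡ tgt f → e ≡ f

module GVC {c ℓ₁ ℓ₂ ℓ₃ : Level} (K : OrderedField c ℓ₁ ℓ₂ ℓ₃) (G : Graph) where
  open OrderedField K
  open Graph G

  record Point : Set c where
    constructor point
    field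
      x : V → Carrier
      y : E → Carrier
      z : E → Carrier

  open Point public

  infix 4 _≋_
  record _≋_ (p q : Point) : Set ℓ₁ where
    field
      x≈ : ∀ i → x p i ≈ x q i
      y≈ : ∀ e → y p e ≈ y q e
      z≈ : ∀ e → z p e ≈ z q e

  convexCombination : Carrier → Point → Point → Point
  convexCombination t p q = point
    (λ i → t * x p i + (1# - t) * x q i)
    (λ e → t * y p e + (1# - t) * y q e)
    (λ e → t * z p e + (1# - t) * z q e)

  record IsExtremePoint {ℓ : Level} (P : Point → Set ℓ) (p : Point)
         : Set (c ⊔ ℓ₁ ⊔ ℓ₃ ⊔ ℓ) where
    field
      member  : P p
      extreme : ∀ {a b} → P a → P b → ∀ {t} → 0# < t → t < 1# →
                p ≋ convexCombination t a b → a ≋ b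

  -- The feasible region of GVC-LP.  The costs c, q⁰, q¹, q² occur only in the
  -- objective, so the region does not depend on them.
  record GVC-LP (p : Point) : Set (ℓ₁ ⊔ ℓ₃) where
    field
      cover : ∀ e → x p (src e) + x p (tgt e) ≤ 1# + y p e
      y≤src : ∀ e → y p e ≤ x p (src e)
      y≤tgt : ∀ e → y p e ≤ x p (tgt e)
      z-def : ∀ e → z p e ≈ 1# - x p (src e) - x p (tgt e) + y p e
      0≤y   : ∀ e → 0# ≤ y p e
      0≤x   : ∀ i → 0# ≤ x p i
      x≤1   : ∀ i → x p i ≤ 1#
      0≤z   : ∀ e → 0# ≤ z p e
      z≤1   : ∀ e → z p e ≤ 1#

{-# OPTIONS --safe #-}

-- At an edge {i , j} the slacks a = y, b = xᵢ − y, c = xⱼ − y and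
-- s = 1 − xᵢ − xⱼ + y are nonnegative and sum to 1.  Moving a by
-- a ((1 − a)(½ − a) − 3 b c), and b, c, s by the same formula with the pairs
-- {a , s}, {a , s}, {b , c} in place of {b , c}, changes no slack by more than
-- its own value, and it moves xᵢ = a + b by xᵢ (1 − xᵢ)(½ − xᵢ), which depends
-- on xᵢ alone.  So this is one feasible move of the whole point, in both
-- directions; at an extreme point it vanishes, and 0, ½, 1 are the only roots.

module Submission where

open import Defs
open import Algebra.Bundles using (CommutativeRing)
import Algebra.Apartness.Properties.HeytingCommutativeRing as HeytingProperties
import Algebra.Properties.AbelianGroup as AbelianGroupProperties
import Algebra.Properties.Ring as RingProperties
import Algebra.Properties.Semiring.Mult.TCOptimised as Multiples
import Algebra.Solver.Ring as RingSolver
open import Algebra.Solver.Ring.AlmostCommutativeRing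
  using (fromCommutativeRing; _-Raw-AlmostCommutative⟶_)
open import Data.Integer.Base as ℤ using (ℤ; +_; -[1+_]; _⊖_)
import Data.Integer.Properties as ℤ
open import Data.Maybe.Base using (Maybe)
import Data.Maybe.Base as Maybe
open import Data.Nat.Base as ℕ using (zero; suc)
open import Data.Product.Base using (_×_; _,_; proj₁; proj₂)
open import Data.Sum.Base using (_⊎_; inj₁; inj₂; [_,_]′)
open import Level using (Level)
import Relation.Binary.PropositionalEquality.Core as ≡
import Relation.Binary.Reasoning.Setoid as SetoidReasoning
open import Relation.Nullary.Decidable using (dec⇒maybe)
open import Relation.Nullary.Negation using (contradiction)

-- Integer coefficients for the ring solver.

module IntegerCoefficients {c ℓ : Level} (R : CommutativeRing c ℓ) where
  open CommutativeRing R
  open Multiples semiring using (×-homo-+; ×1-homo-*; 1+×) renaming (_×_ to _·_)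
  open RingProperties ring
    using (-0#≈0#; -‿distribˡ-*; -‿distribʳ-*; -‿involutive)
  open AbelianGroupProperties +-abelianGroup using (⁻¹-∙-comm)
  open SetoidReasoning setoid

  -- The optimised multiples make `1 · 1#` reduce to `1#`, so `con (+ 1)` in a solver term matches
  -- `1#` definitionally.
  ⟦_⟧ : ℤ → Carrier
  ⟦ + n      ⟧ = n · 1#
  ⟦ -[1+ n ] ⟧ = - (suc n · 1#)

  private
    cancel-1+ : ∀ a b → a - b ≈ (1# + a) - (1# + b)
    cancel-1+ a b = begin
      a - b                      ≈⟨ +-identityˡ _ ⟨
      0# + (a - b)               ≈⟨ +-congʳ (-‿inverseʳ 1#) ⟨
      (1# - 1#) + (a - b)        ≈⟨ +-assoc _ _ _ ⟩
      1# + (- 1# + (a - b))      ≈⟨ +-congˡ (+-assoc _ _ _) ⟨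
      1# + ((- 1# + a) - b)      ≈⟨ +-congˡ (+-congʳ (+-comm _ _)) ⟩
      1# + ((a - 1#) - b)        ≈⟨ +-congˡ (+-assoc _ _ _) ⟩
      1# + (a + (- 1# - b))      ≈⟨ +-assoc _ _ _ ⟨
      (1# + a) + (- 1# - b)      ≈⟨ +-congˡ (⁻¹-∙-comm 1# b) ⟩
      (1# + a) - (1# + b)        ∎

  ⊖-homo : ∀ m n → ⟦ m ⊖ n ⟧ ≈ m · 1# - n · 1#
  ⊖-homo zero    zero    = sym (-‿inverseʳ 0#)
  ⊖-homo zero    (suc n) = sym (+-identityˡ _)
  ⊖-homo (suc m) zero    = sym (trans (+-congˡ -0#≈0#) (+-identityʳ _))
  ⊖-homo (suc m) (suc n) = begin
    ⟦ suc m ⊖ suc n ⟧                  ≡⟨ ≡.cong ⟦_⟧ (ℤ.[1+m]⊖[1+n]≡m⊖n m n) ⟩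
    ⟦ m ⊖ n ⟧                          ≈⟨ ⊖-homo m n ⟩
    m · 1# - n · 1#                    ≈⟨ cancel-1+ _ _ ⟩
    (1# + m · 1#) - (1# + n · 1#)      ≈⟨ +-cong (1+× m 1#) (-‿cong (1+× n 1#)) ⟨
    suc m · 1# - suc n · 1#            ∎

  +-homo : ∀ i j → ⟦ i ℤ.+ j ⟧ ≈ ⟦ i ⟧ + ⟦ j ⟧
  +-homo (+ m)    (+ n)    = ×-homo-+ 1# m n
  +-homo (+ m)    -[1+ n ] = ⊖-homo m (suc n)
  +-homo -[1+ m ] (+ n)    = trans (⊖-homo n (suc m)) (+-comm _ _)
  +-homo -[1+ m ] -[1+ n ] = begin
    ⟦ -[1+ m ] ℤ.+ -[1+ n ] ⟧           ≡⟨ ≡.cong ⟦_⟧ (ℤ.neg-distrib-+ (+ suc m) (+ suc n)) ⟨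
    - ((suc m ℕ.+ suc n) · 1#)          ≈⟨ -‿cong (×-homo-+ 1# (suc m) (suc n)) ⟩
    - (suc m · 1# + suc n · 1#)         ≈⟨ ⁻¹-∙-comm _ _ ⟨
    - (suc m · 1#) - suc n · 1#         ∎

  -‿homo : ∀ i → ⟦ ℤ.- i ⟧ ≈ - ⟦ i ⟧
  -‿homo (+ zero)  = sym -0#≈0#
  -‿homo (+ suc n) = refl
  -‿homo -[1+ n ]  = sym (-‿involutive _)

  pos-*-pos-homo : ∀ m n → ⟦ + m ℤ.* + n ⟧ ≈ ⟦ + m ⟧ * ⟦ + n ⟧
  pos-*-pos-homo m n = begin
    ⟦ + m ℤ.* + n ⟧       ≡⟨ ≡.cong ⟦_⟧ (ℤ.pos-* m n) ⟨
    (m ℕ.* n) · 1#        ≈⟨ ×1-homo-* m n ⟩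
    (m · 1#) * (n · 1#)   ∎

  pos-*-homo : ∀ m j → ⟦ + m ℤ.* j ⟧ ≈ ⟦ + m ⟧ * ⟦ j ⟧
  pos-*-homo m (+ n)    = pos-*-pos-homo m n
  pos-*-homo m -[1+ n ] = begin
    ⟦ + m ℤ.* -[1+ n ] ⟧         ≡⟨ ≡.cong ⟦_⟧ (ℤ.neg-distribʳ-* (+ m) (+ suc n)) ⟨
    ⟦ ℤ.- (+ m ℤ.* + suc n) ⟧    ≈⟨ -‿homo (+ m ℤ.* + suc n) ⟩
    - ⟦ + m ℤ.* + suc n ⟧        ≈⟨ -‿cong (pos-*-pos-homo m (suc n)) ⟩
    - ((m · 1#) * (suc n · 1#))  ≈⟨ -‿distribʳ-* _ _ ⟩
    (m · 1#) * - (suc n · 1#)    ∎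

  *-homo : ∀ i j → ⟦ i ℤ.* j ⟧ ≈ ⟦ i ⟧ * ⟦ j ⟧
  *-homo (+ m)    j = pos-*-homo m j
  *-homo -[1+ m ] j = begin
    ⟦ -[1+ m ] ℤ.* j ⟧           ≡⟨ ≡.cong ⟦_⟧ (ℤ.neg-distribˡ-* (+ suc m) j) ⟨
    ⟦ ℤ.- (+ suc m ℤ.* j) ⟧      ≈⟨ -‿homo (+ suc m ℤ.* j) ⟩
    - ⟦ + suc m ℤ.* j ⟧          ≈⟨ -‿cong (pos-*-homo (suc m) j) ⟩
    - ((suc m · 1#) * ⟦ j ⟧)     ≈⟨ -‿distribˡ-* _ _ ⟩
    - (suc m · 1#) * ⟦ j ⟧       ∎

  morphism : ℤ.+-*-rawRing -Raw-AlmostCommutative⟶ fromCommutativeRing R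
  morphism = record
    { ⟦_⟧    = ⟦_⟧
    ; +-homo = +-homo
    ; *-homo = *-homo
    ; -‿homo = -‿homo
    ; 0-homo = refl
    ; 1-homo = refl
    }

  _coeff≟_ : ∀ i j → Maybe (⟦ i ⟧ ≈ ⟦ j ⟧)
  i coeff≟ j = Maybe.map (λ i≡j → reflexive (≡.cong ⟦_⟧ i≡j)) (dec⇒maybe (i ℤ.≟ j))

  open RingSolver ℤ.+-*-rawRing (fromCommutativeRing R) morphism _coeff≟_ public
    using (Polynomial; con; _:+_; _:*_; _:-_; :-_; _:=_; solve)

-- Order and cancellation without assuming decidability.

module OrderedFieldProperties {c ℓ₁ ℓ₂ ℓ₃ : Level} (K : OrderedField c ℓ₁ ℓ₂ ℓ₃) where
  open OrderedField K
  open HeytingProperties heytingCommutativeRing using (invertibleˡ⇒#; #-congʳ)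
  open RingProperties ring using (x∙y⁻¹≈ε⇒x≈y)
  open IntegerCoefficients commutativeRing public
  open SetoidReasoning setoid

  -- Stands in for trichotomy. Cotransitivity of apartness separates `m` from `a` or from `b`; if
  -- the order then points the wrong way, transitivity yields the other disjunct.
  <-cotrans : ∀ {a b} → a < b → ∀ m → a < m ⊎ m < b
  <-cotrans {a} {b} a<b m with #-cotrans (<⇒# a<b) m
  ... | inj₁ a#m with #⇒<∨> a#m
  ...   | inj₁ a<m = inj₁ a<m
  ...   | inj₂ m<a = inj₂ (<-trans m<a a<b)
  <-cotrans {a} {b} a<b m | inj₂ m#b with #⇒<∨> m#b
  ...   | inj₁ m<b = inj₂ m<b
  ...   | inj₂ b<m = inj₁ (<-trans a<b b<m)

  a+[b-a]≈b : ∀ a b → a + (b - a) ≈ b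
  a+[b-a]≈b = solve 2 (λ a b → a :+ (b :- a) := b) refl

  b<a⇒b-a<0 : ∀ {a b} → b < a → b - a < 0#
  b<a⇒b-a<0 {a} b<a =
    <-respˡ-≈ (+-comm _ _) (<-respʳ-≈ (-‿inverseˡ a) (+-monoʳ-< (- a) b<a))

  b-a<0⇒b<a : ∀ {a b} → b - a < 0# → b < a
  b-a<0⇒b<a {a} {b} b-a<0 =
    <-respˡ-≈ (a+[b-a]≈b a b) (<-respʳ-≈ (+-identityʳ a) (+-monoʳ-< a b-a<0))

  a≤b⇒0≤b-a : ∀ {a b} → a ≤ b → 0# ≤ b - a
  a≤b⇒0≤b-a a≤b b-a<0 = a≤b (b-a<0⇒b<a b-a<0)

  0≤b-a⇒a≤b : ∀ {a b} → 0# ≤ b - a → a ≤ b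
  0≤b-a⇒a≤b 0≤b-a b<a = 0≤b-a (b<a⇒b-a<0 b<a)

  0≤-resp-≈ : ∀ {a b} → a ≈ b → 0# ≤ a → 0# ≤ b
  0≤-resp-≈ a≈b 0≤a b<0 = 0≤a (<-respˡ-≈ (sym a≈b) b<0)

  0≤0 : 0# ≤ 0#
  0≤0 = <-irrefl refl

  0≤1 : 0# ≤ 1#
  0≤1 = <-asym 0<1

  -- Comparing `a` with both ends of `a + b < 0#` would make `a` or `b` negative.
  +-nonneg : ∀ {a b} → 0# ≤ a → 0# ≤ b → 0# ≤ a + b
  +-nonneg {a} {b} 0≤a 0≤b a+b<0 with <-cotrans a+b<0 a
  ... | inj₂ a<0   = 0≤a a<0
  ... | inj₁ a+b<a = 0≤b (<-respˡ-≈ cancel (b<a⇒b-a<0 a+b<a))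
    where
    cancel : a + b - a ≈ b
    cancel = solve 2 (λ a b → a :+ b :- a := b) refl a b

  -- If `v` inverts `a * b`, then `v * b` inverts `a`.
  *-#0⇒#0ˡ : ∀ {a b} → a * b # 0# → a # 0#
  *-#0⇒#0ˡ {a} {b} ab#0 with #⇒invertible ab#0
  ... | v , v*[ab-0]≈1 , _ = invertibleˡ⇒# (v * b , (begin
    v * b * (a - 0#)    ≈⟨ solve 3 (λ v b a → v :* b :* (a :- con (+ 0)) := v :* (a :* b :- con (+ 0))) refl v b a ⟩
    v * (a * b - 0#)    ≈⟨ v*[ab-0]≈1 ⟩
    1#                  ∎))

  *-#0⇒#0ʳ : ∀ {a b} → a * b # 0# → b # 0#
  *-#0⇒#0ʳ {a} {b} ab#0 =
    *-#0⇒#0ˡ (#-congʳ (*-comm a b) ab#0)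

  0≤∧#0⇒0< : ∀ {a} → 0# ≤ a → a # 0# → 0# < a
  0≤∧#0⇒0< 0≤a a#0 with #⇒<∨> a#0
  ... | inj₁ a<0 = contradiction a<0 0≤a
  ... | inj₂ 0<a = 0<a

  -- No case split on signs is available. Instead, `a * b < 0#` would make both factors apart from
  -- zero, hence positive, and so their product positive.
  *-nonneg : ∀ {a b} → 0# ≤ a → 0# ≤ b → 0# ≤ a * b
  *-nonneg 0≤a 0≤b ab<0 = <-asym ab<0
    (*-pos (0≤∧#0⇒0< 0≤a (*-#0⇒#0ˡ (<⇒# ab<0))) (0≤∧#0⇒0< 0≤b (*-#0⇒#0ʳ (<⇒# ab<0))))

  a#b∧[a-b]c≈0⇒c≈0 : ∀ {a b c} → a # b → (a - b) * c ≈ 0# → c ≈ 0#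
  a#b∧[a-b]c≈0⇒c≈0 {a} {b} {c} a#b [a-b]c≈0 with #⇒invertible a#b
  ... | v , v*[a-b]≈1 , _ = begin
    c                   ≈⟨ *-identityˡ c ⟨
    1# * c              ≈⟨ *-congʳ v*[a-b]≈1 ⟨
    v * (a - b) * c     ≈⟨ *-assoc _ _ _ ⟩
    v * ((a - b) * c)   ≈⟨ *-congˡ [a-b]c≈0 ⟩
    v * 0#              ≈⟨ zeroʳ v ⟩
    0#                  ∎

  a-b≈0⇒a≈b : ∀ {a b} → a - b ≈ 0# → a ≈ b
  a-b≈0⇒a≈b = x∙y⁻¹≈ε⇒x≈y _ _

  -- The solver treats ½ as a variable, so identities that need 2 ½ = 1 are handed
  -- to it with an explicit multiple of 1 − 2 ½ on the right.
  ≈-modulo-1-2½ : ∀ {u v} w → u ≈ v + (1# - 2# * ½) * w → u ≈ v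
  ≈-modulo-1-2½ {u} {v} w u≈ = begin
    u                         ≈⟨ u≈ ⟩
    v + (1# - 2# * ½) * w     ≈⟨ +-congˡ (*-congʳ (+-congˡ (-‿cong 2*½≈1))) ⟩
    v + (1# - 1#) * w         ≈⟨ solve 2 (λ v w → v :+ (con (+ 1) :- con (+ 1)) :* w := v) refl v w ⟩
    v                         ∎

  ½+½≈1 : ½ + ½ ≈ 1#
  ½+½≈1 = trans (solve 1 (λ h → h :+ h := (con (+ 1) :+ con (+ 1)) :* h) refl ½) 2*½≈1

  -- Comparing `½` with `0# < 1#` either settles the claim or gives `½ < 1#`; then `1# - ½`, which
  -- equals `½`, is positive.
  0<½ : 0# < ½
  0<½ with <-cotrans 0<1 ½
  ... | inj₁ 0<½ = 0<½
  ... | inj₂ ½<1 = <-respˡ-≈ (-‿inverseʳ ½) (<-respʳ-≈ 1-½≈½ (<-respˡ-≈ (+-comm _ _)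
                     (<-respʳ-≈ (+-comm _ _) (+-monoʳ-< (- ½) ½<1))))
    where
    1-½≈½ : 1# - ½ ≈ ½
    1-½≈½ = ≈-modulo-1-2½ 1# (solve 1 (λ h →
      let one = con (+ 1) in one :- h := h :+ (one :- (one :+ one) :* h) :* one) refl ½)

  ½<1 : ½ < 1#
  ½<1 = <-respˡ-≈ (+-identityʳ ½) (<-respʳ-≈ ½+½≈1 (+-monoʳ-< ½ 0<½))

  -- Two-sided bounds and the cubic move.

  infix 4 ∣_∣≤_
  -- Encodes |v| ≤ u by the two facts that get used: a slack `u` stays nonnegative when moved by `v`
  -- and by `- v`.
  ∣_∣≤_ : Carrier → Carrier → Set ℓ₃
  ∣ v ∣≤ u = 0# ≤ u + v × 0# ≤ u - v

  ∣∣≤-resp-≈ : ∀ {u v w} → v ≈ w → ∣ v ∣≤ u → ∣ w ∣≤ u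
  ∣∣≤-resp-≈ v≈w (0≤u+v , 0≤u-v) =
    0≤-resp-≈ (+-congˡ v≈w) 0≤u+v , 0≤-resp-≈ (+-congˡ (-‿cong v≈w)) 0≤u-v

  ∣-∣≤ : ∀ {u v} → ∣ v ∣≤ u → ∣ - v ∣≤ u
  ∣-∣≤ {u} {v} (0≤u+v , 0≤u-v) =
    0≤u-v , 0≤-resp-≈ (solve 2 (λ u v → u :+ v := u :- (:- v)) refl u v) 0≤u+v

  shift : Carrier → Carrier → Carrier → Carrier
  shift a b c = a * ((1# - a) * (½ - a) - (b * c + b * c + b * c))

  one : ∀ {n} → Polynomial n
  one = con (+ 1)

  private
    1-2_ : ∀ {n} → Polynomial n → Polynomial n
    1-2 h = one :- (one :+ one) :* h

    shiftᴾ : ∀ {n} → (h a b c : Polynomial n) → Polynomial n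
    shiftᴾ h a b c = a :* ((one :- a) :* (h :- a) :- (b :* c :+ b :* c :+ b :* c))

  -- Both `a + shift a b c` and `a - shift a b c` factor as `a` times an expression built from
  -- nonnegative terms by sums and products.
  ∣shift∣≤ : ∀ {a b c} → 0# ≤ a → 0# ≤ b → 0# ≤ c → 0# ≤ 1# - a - b - c →
             ∣ shift a b c ∣≤ a
  ∣shift∣≤ {a} {b} {c} 0≤a 0≤b 0≤c 0≤s =
    0≤-resp-≈ (sym upper) (*-nonneg 0≤a (*-nonneg 0≤½
      (+-nonneg (+-nonneg (*-nonneg 0≤a 0≤a) (*-nonneg 0≤a 0≤a)) (+-nonneg (+-nonneg 0≤w 0≤w) 0≤w)))) ,
    0≤-resp-≈ (sym lower) (*-nonneg 0≤a
      (+-nonneg (+-nonneg (*-nonneg 0≤½ (+-nonneg 0≤1 0≤a)) (*-nonneg 0≤1-a 0≤a))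
        (+-nonneg (+-nonneg 0≤bc 0≤bc) 0≤bc)))
    where
    m s w : Carrier
    m = 1# - a
    s = 1# - a - b - c
    -- This is 1 - a - 2bc in visibly nonnegative terms: a m + m² = m because a + m = 1, and m² - (b
    -- + c)² = s (m + b + c) because m = b + c + s.
    w = a * m + b * b + c * c + s * (m + b + c)

    0≤½ : 0# ≤ ½
    0≤½ = <-asym 0<½

    0≤bc : 0# ≤ b * c
    0≤bc = *-nonneg 0≤b 0≤c

    0≤1-a : 0# ≤ m
    0≤1-a = 0≤-resp-≈
      (solve 3 (λ a b c → (one :- a :- b :- c) :+ b :+ c := one :- a) refl a b c)
      (+-nonneg (+-nonneg 0≤s 0≤b) 0≤c)

    0≤w : 0# ≤ w
    0≤w = +-nonneg (+-nonneg (+-nonneg (*-nonneg 0≤a 0≤1-a) (*-nonneg 0≤b 0≤b)) (*-nonneg 0≤c 0≤c))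
            (*-nonneg 0≤s (+-nonneg (+-nonneg 0≤1-a 0≤b) 0≤c))

    upper : a + shift a b c ≈ a * (½ * (a * a + a * a + (w + w + w)))
    upper = ≈-modulo-1-2½ (a * (1# - a * (1# - a) - (b * c + b * c + b * c)))
      (solve 4 (λ h a b c →
        let m = one :- a
            s = one :- a :- b :- c
            w = a :* m :+ b :* b :+ c :* c :+ s :* (m :+ b :+ c)
        in a :+ shiftᴾ h a b c :=
           a :* (h :* (a :* a :+ a :* a :+ (w :+ w :+ w)))
           :+ 1-2 h :* (a :* (one :- a :* (one :- a) :- (b :* c :+ b :* c :+ b :* c))))
        refl ½ a b c)

    lower : a - shift a b c ≈ a * (½ * (1# + a) + m * a + (b * c + b * c + b * c))
    lower = ≈-modulo-1-2½ a
      (solve 4 (λ h a b c →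
        a :- shiftᴾ h a b c :=
        a :* (h :* (one :+ a) :+ (one :- a) :* a :+ (b :* c :+ b :* c :+ b :* c)) :+ 1-2 h :* a)
        refl ½ a b c)

  -- The cubic a (1 - a)(½ - a), kept as an instance of `shift` so that `∣shift∣≤` covers it.
  shift₀ : Carrier → Carrier
  shift₀ a = shift a 0# 0#

  -- The cubic is odd about ½, so its bound by `x` also yields a bound by `1# - x`.
  shift₀-reflect : ∀ a → shift₀ (1# - a) ≈ - shift₀ a
  shift₀-reflect a = ≈-modulo-1-2½ (- (a * (1# - a)))
    (solve 2 (λ h a → let o = con (+ 0) in
      shiftᴾ h (one :- a) o o := :- shiftᴾ h a o o :+ 1-2 h :* (:- (a :* (one :- a)))) refl ½ a)

  ∣shift₀∣≤ : ∀ {a} → 0# ≤ a → 0# ≤ 1# - a → ∣ shift₀ a ∣≤ a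
  ∣shift₀∣≤ {a} 0≤a 0≤1-a = ∣shift∣≤ 0≤a 0≤0 0≤0
    (0≤-resp-≈ (solve 1 (λ a → one :- a := one :- a :- con (+ 0) :- con (+ 0)) refl a) 0≤1-a)

  -- Let g be the cubic `shift₀`. Then g(a + b) - g(a) - g(b) = -3ab(1 - a - b). With a = y, b = i -
  -- y and 1 - a - b = c + s, this is the sum of the corrections -3abc and -3abs in the moves of a
  -- and b.
  shift-sum : ∀ i j y →
    shift₀ i - shift y (i - y) (j - y) ≈ shift (i - y) y (1# - i - j + y)
  shift-sum i j y = ≈-modulo-1-2½ (y * (i - y))
    (solve 4 (λ h i j y → let o = con (+ 0) in
      shiftᴾ h i o o :- shiftᴾ h y (i :- y) (j :- y) :=
      shiftᴾ h (i :- y) y (one :- i :- j :+ y) :+ 1-2 h :* (y :* (i :- y))) refl ½ i j y)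

  shift-comm : ∀ a b c → shift a b c ≈ shift a c b
  shift-comm = solve 4 (λ h a b c → shiftᴾ h a b c := shiftᴾ h a c b) refl ½

  -- The moves of c = j - y and s add up to g(c + s) = g(1 - i) = -g(i), by the identity behind
  -- `shift-sum` and by reflection, while the move of c is g(j) minus the move of y.
  shift-complement : ∀ i j y →
    shift y (i - y) (j - y) - shift₀ i - shift₀ j ≈ shift (1# - i - j + y) (i - y) (j - y)
  shift-complement i j y =
    ≈-modulo-1-2½ (i + j - y - i * i - j * j + y * i + y * j - i * j)
    (solve 4 (λ h i j y → let o = con (+ 0) in
      shiftᴾ h y (i :- y) (j :- y) :- shiftᴾ h i o o :- shiftᴾ h j o o :=
      shiftᴾ h (one :- i :- j :+ y) (i :- y) (j :- y)
      :+ 1-2 h :* (i :+ j :- y :- i :* i :- j :* j :+ y :* i :+ y :* j :- i :* j))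
      refl ½ i j y)

  -- Two comparisons place `a` in one of the overlapping regions a < ½, 0 < a < 1 and ½ < a. In
  -- each, two of the three linear factors are invertible, and cancelling them leaves the third.
  shift₀-root : ∀ a → shift₀ a ≈ 0# → a ≈ 0# ⊎ a ≈ ½ ⊎ a ≈ 1#
  shift₀-root a shift≈0 =
    [ (λ 0<a → inj₂ ([ (λ ½<a → inj₂ (½<a⇒a≈1 0<a ½<a)) , (λ a<1 → inj₁ (a<1⇒a≈½ 0<a a<1)) ]′
        (<-cotrans ½<1 a)))
    , (λ a<½ → inj₁ (a<½⇒a≈0 a<½))
    ]′ (<-cotrans 0<½ a)
    where
    a[½-a][1-a]≈0 : (a - 0#) * ((½ - a) * (1# - a)) ≈ 0#
    a[½-a][1-a]≈0 = trans (solve 2 (λ h a → let o = con (+ 0) in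
      (a :- o) :* ((h :- a) :* (one :- a)) := shiftᴾ h a o o) refl ½ a) shift≈0

    [½-a][1-a]≈0 : 0# < a → (½ - a) * (1# - a) ≈ 0#
    [½-a][1-a]≈0 0<a = a#b∧[a-b]c≈0⇒c≈0 (#-sym (<⇒# 0<a)) a[½-a][1-a]≈0

    ½<a⇒a≈1 : 0# < a → ½ < a → a ≈ 1#
    ½<a⇒a≈1 0<a ½<a = sym (a-b≈0⇒a≈b (a#b∧[a-b]c≈0⇒c≈0 (<⇒# ½<a) ([½-a][1-a]≈0 0<a)))

    a<1⇒a≈½ : 0# < a → a < 1# → a ≈ ½
    a<1⇒a≈½ 0<a a<1 = sym (a-b≈0⇒a≈b (a#b∧[a-b]c≈0⇒c≈0 (#-sym (<⇒# a<1))
      (trans (*-comm _ _) ([½-a][1-a]≈0 0<a))))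

    a<½⇒a≈0 : a < ½ → a ≈ 0#
    a<½⇒a≈0 a<½ = a-b≈0⇒a≈b (a#b∧[a-b]c≈0⇒c≈0 (#-sym (<⇒# a<½))
      (a#b∧[a-b]c≈0⇒c≈0 (#-sym (<⇒# (<-trans a<½ ½<1))) (trans
        (solve 2 (λ h a → let o = con (+ 0) in
          (one :- a) :* ((h :- a) :* (a :- o)) := (a :- o) :* ((h :- a) :* (one :- a))) refl ½ a)
        a[½-a][1-a]≈0)))

  -- Midpoints and halving.

  midpoint : ∀ u v → u ≈ ½ * (u + v) + (1# - ½) * (u - v)
  midpoint u v = ≈-modulo-1-2½ v (solve 3 (λ h u v →
    u := h :* (u :+ v) :+ (one :- h) :* (u :- v) :+ 1-2 h :* v) refl ½ u v)

  u+v≈u-v⇒v≈0 : ∀ {u v} → u + v ≈ u - v → v ≈ 0#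
  u+v≈u-v⇒v≈0 {u} {v} u+v≈u-v = begin
    v                             ≈⟨ ≈-modulo-1-2½ v (solve 3 (λ h u v →
                                       v := h :* ((u :+ v) :- (u :- v)) :+ 1-2 h :* v) refl ½ u v) ⟩
    ½ * ((u + v) - (u - v))       ≈⟨ *-congˡ (+-congʳ u+v≈u-v) ⟩
    ½ * ((u - v) - (u - v))       ≈⟨ *-congˡ (-‿inverseʳ _) ⟩
    ½ * 0#                        ≈⟨ zeroʳ ½ ⟩
    0#                            ∎

-- Feasible moves in the polyhedron.

module _ {c ℓ₁ ℓ₂ ℓ₃ : Level} (K : OrderedField c ℓ₁ ℓ₂ ℓ₃) (G : Graph) where
  open OrderedField K
  open OrderedFieldProperties K
  open Graph G
  open GVC K G

  slack : Point → E → Carrier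
  slack p e = 1# - x p (src e) - x p (tgt e) + y p e

  -- The z-coordinates are recomputed from the moved x and y, so `z-def` holds by `refl`.
  translate : Point → (V → Carrier) → (E → Carrier) → Point
  translate p u v = point x′ y′ (λ e → 1# - x′ (src e) - x′ (tgt e) + y′ e)
    where
    x′ : V → Carrier
    x′ i = x p i + u i
    y′ : E → Carrier
    y′ e = y p e + v e

  -- The bounds on x are stated per vertex, as a vertex may lie on no edge. The bound `at-slack`
  -- serves both `cover` and `0≤z`.
  record Dominated (p : Point) (u : V → Carrier) (v : E → Carrier) : Set ℓ₃ where
    field
      at-x     : ∀ i → ∣ u i ∣≤ x p i
      at-1-x   : ∀ i → ∣ - u i ∣≤ 1# - x p i
      at-y     : ∀ e → ∣ v e ∣≤ y p e
      at-src   : ∀ e → ∣ u (src e) - v e ∣≤ x p (src e) - y p e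
      at-tgt   : ∀ e → ∣ u (tgt e) - v e ∣≤ x p (tgt e) - y p e
      at-slack : ∀ e → ∣ v e - u (src e) - u (tgt e) ∣≤ slack p e

  -- The bounds are symmetric in sign; this makes the opposite move feasible as well.
  Dominated-neg : ∀ {p u v} → Dominated p u v → Dominated p (λ i → - u i) (λ e → - v e)
  Dominated-neg {u = u} {v} d = record
    { at-x     = λ i → ∣-∣≤ (at-x i)
    ; at-1-x   = λ i → ∣-∣≤ (at-1-x i)
    ; at-y     = λ e → ∣-∣≤ (at-y e)
    ; at-src   = λ e → ∣∣≤-resp-≈ (neg-difference (u (src e)) (v e)) (∣-∣≤ (at-src e))
    ; at-tgt   = λ e → ∣∣≤-resp-≈ (neg-difference (u (tgt e)) (v e)) (∣-∣≤ (at-tgt e))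
    ; at-slack = λ e → ∣∣≤-resp-≈
        (solve 3 (λ a b c → :- (c :- a :- b) := :- c :- :- a :- :- b) refl (u (src e)) (u (tgt e)) (v e))
        (∣-∣≤ (at-slack e))
    }
    where
    open Dominated d
    neg-difference : ∀ a b → - (a - b) ≈ - a - - b
    neg-difference = solve 2 (λ a b → :- (a :- b) := :- a :- :- b) refl

  translate-feasible : ∀ {p u v} → Dominated p u v → GVC-LP (translate p u v)
  translate-feasible {p} {u} {v} d = record
    { cover = λ e → 0≤b-a⇒a≤b (0≤-resp-≈
        (solve 3 (λ i j y → one :- i :- j :+ y := one :+ y :- (i :+ j)) refl
          (x p′ (src e)) (x p′ (tgt e)) (y p′ e))
        (0≤slack e))
    ; y≤src = λ e → 0≤b-a⇒a≤b (0≤src-y e)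
    ; y≤tgt = λ e → 0≤b-a⇒a≤b (0≤tgt-y e)
    ; z-def = λ e → refl
    ; 0≤y   = λ e → proj₁ (at-y e)
    ; 0≤x   = 0≤x′
    ; x≤1   = λ i → 0≤b-a⇒a≤b (0≤-resp-≈
        (solve 2 (λ i u → one :- i :+ :- u := one :- (i :+ u)) refl (x p i) (u i))
        (proj₁ (at-1-x i)))
    ; 0≤z   = 0≤slack
    -- Here 1 - z = (xᵢ - y) + xⱼ, a sum of two quantities already known to be nonnegative.
    ; z≤1   = λ e → 0≤b-a⇒a≤b (0≤-resp-≈
        (solve 3 (λ i j y → (i :- y) :+ j := one :- (one :- i :- j :+ y)) refl
          (x p′ (src e)) (x p′ (tgt e)) (y p′ e))
        (+-nonneg (0≤src-y e) (0≤x′ (tgt e))))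
    }
    where
    open Dominated d

    p′ : Point
    p′ = translate p u v

    0≤x′ : ∀ i → 0# ≤ x p′ i
    0≤x′ i = proj₁ (at-x i)

    regroup : ∀ a b c d → (a - b) + (c - d) ≈ (a + c) - (b + d)
    regroup = solve 4 (λ a b c d → (a :- b) :+ (c :- d) := (a :+ c) :- (b :+ d)) refl

    0≤src-y : ∀ e → 0# ≤ x p′ (src e) - y p′ e
    0≤src-y e = 0≤-resp-≈ (regroup _ _ _ _) (proj₁ (at-src e))

    0≤tgt-y : ∀ e → 0# ≤ x p′ (tgt e) - y p′ e
    0≤tgt-y e = 0≤-resp-≈ (regroup _ _ _ _) (proj₁ (at-tgt e))

    0≤slack : ∀ e → 0# ≤ slack p′ e
    0≤slack e = 0≤-resp-≈
      (solve 6 (λ i j y a b c →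
        (one :- i :- j :+ y) :+ (c :- a :- b) := one :- (i :+ a) :- (j :+ b) :+ (y :+ c)) refl
        (x p (src e)) (x p (tgt e)) (y p e) (u (src e)) (u (tgt e)) (v e))
      (proj₁ (at-slack e))

  translate-midpoint : ∀ {p u v} → (∀ e → z p e ≈ slack p e) →
    p ≋ convexCombination ½ (translate p u v) (translate p (λ i → - u i) (λ e → - v e))
  translate-midpoint {p} {u} {v} z≈slack = record
    { x≈ = λ i → midpoint _ _
    ; y≈ = λ e → midpoint _ _
    -- Once z is replaced by its defining expression, which is affine in x and y, its midpoint
    -- identity follows from that of the slack.
    ; z≈ = λ e → trans (z≈slack e) (trans (midpoint _ (v e - u (src e) - u (tgt e)))
        (solve 7 (λ h i j y a b c →
          let s = one :- i :- j :+ y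
              d = c :- a :- b
          in h :* (s :+ d) :+ (one :- h) :* (s :- d) :=
             h :* (one :- (i :+ a) :- (j :+ b) :+ (y :+ c))
             :+ (one :- h) :* (one :- (i :- a) :- (j :- b) :+ (y :- c))) refl
          ½ (x p (src e)) (x p (tgt e)) (y p e) (u (src e)) (u (tgt e)) (v e)))
    }

  shiftˣ : Point → V → Carrier
  shiftˣ p i = shift₀ (x p i)

  shiftʸ : Point → E → Carrier
  shiftʸ p e = shift (y p e) (x p (src e) - y p e) (x p (tgt e) - y p e)

  -- The four slacks of an edge sum to 1, so in each edge bound the last premise of `∣shift∣≤` is
  -- the nonnegativity of the one slack not among its arguments.
  shift-dominated : ∀ {p} → GVC-LP p → Dominated p (shiftˣ p) (shiftʸ p)
  shift-dominated {p} feasible = record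
    { at-x     = λ i → ∣shift₀∣≤ (0≤x i) (0≤1-x i)
    ; at-1-x   = λ i → ∣∣≤-resp-≈ (shift₀-reflect (x p i))
        (∣shift₀∣≤ (0≤1-x i)
          (0≤-resp-≈ (solve 1 (λ a → a := one :- (one :- a)) refl (x p i)) (0≤x i)))
    ; at-y     = λ e → ∣shift∣≤ (0≤y e) (0≤src-y e) (0≤tgt-y e) (0≤-resp-≈
        (solve 3 (λ i j y → one :- i :- j :+ y := one :- y :- (i :- y) :- (j :- y)) refl
          (x p (src e)) (x p (tgt e)) (y p e))
        (0≤slack e))
    ; at-src   = λ e → ∣∣≤-resp-≈ (sym (shift-sum (x p (src e)) (x p (tgt e)) (y p e)))
        (∣shift∣≤ (0≤src-y e) (0≤y e) (0≤slack e) (0≤-resp-≈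
          (solve 3 (λ i j y → j :- y := one :- (i :- y) :- y :- (one :- i :- j :+ y)) refl
            (x p (src e)) (x p (tgt e)) (y p e))
          (0≤tgt-y e)))
    ; at-tgt   = λ e → ∣∣≤-resp-≈ (tgt-shift e)
        (∣shift∣≤ (0≤tgt-y e) (0≤y e) (0≤-resp-≈ (slack-comm e) (0≤slack e)) (0≤-resp-≈
          (solve 3 (λ i j y → i :- y := one :- (j :- y) :- y :- (one :- j :- i :+ y)) refl
            (x p (src e)) (x p (tgt e)) (y p e))
          (0≤src-y e)))
    ; at-slack = λ e → ∣∣≤-resp-≈ (sym (shift-complement (x p (src e)) (x p (tgt e)) (y p e)))
        (∣shift∣≤ (0≤slack e) (0≤src-y e) (0≤tgt-y e) (0≤-resp-≈
          (solve 3 (λ i j y → y := one :- (one :- i :- j :+ y) :- (i :- y) :- (j :- y)) refl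
            (x p (src e)) (x p (tgt e)) (y p e))
          (0≤y e)))
    }
    where
    open GVC-LP feasible

    0≤1-x : ∀ i → 0# ≤ 1# - x p i
    0≤1-x i = a≤b⇒0≤b-a (x≤1 i)

    0≤src-y : ∀ e → 0# ≤ x p (src e) - y p e
    0≤src-y e = a≤b⇒0≤b-a (y≤src e)

    0≤tgt-y : ∀ e → 0# ≤ x p (tgt e) - y p e
    0≤tgt-y e = a≤b⇒0≤b-a (y≤tgt e)

    0≤slack : ∀ e → 0# ≤ slack p e
    0≤slack e = 0≤-resp-≈ (z-def e) (0≤z e)

    slack-comm : ∀ e → slack p e ≈ 1# - x p (tgt e) - x p (src e) + y p e
    slack-comm e = solve 3 (λ i j y → one :- i :- j :+ y := one :- j :- i :+ y) refl
      (x p (src e)) (x p (tgt e)) (y p e)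

    -- `shift-sum` with the endpoints exchanged; `shiftʸ` lists the source first, hence the appeal
    -- to `shift-comm`.
    tgt-shift : ∀ e → shift (x p (tgt e) - y p e) (y p e) (1# - x p (tgt e) - x p (src e) + y p e)
                      ≈ shiftˣ p (tgt e) - shiftʸ p e
    tgt-shift e = trans (sym (shift-sum (x p (tgt e)) (x p (src e)) (y p e)))
      (+-congˡ (-‿cong (shift-comm (y p e) (x p (tgt e) - y p e) (x p (src e) - y p e))))

-- Half-integrality at an extreme point.

theorem5 : {c ℓ₁ ℓ₂ ℓ₃ : Level} (K : OrderedField c ℓ₁ ℓ₂ ℓ₃) (G : Graph) →
    let open OrderedField K
        open Graph G
        open GVC K G
    in (p : Point) → IsExtremePoint GVC-LP p →
       (i : V) → x p i ≈ 0# ⊎ x p i ≈ ½ ⊎ x p i ≈ 1#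
theorem5 K G p extremePoint i = shift₀-root (x p i) (u+v≈u-v⇒v≈0 (x≈ p+≋p- i))
  where
  open OrderedField K
  open OrderedFieldProperties K
  open GVC K G
  open IsExtremePoint extremePoint
  open _≋_

  dominated : Dominated K G p (shiftˣ K G p) (shiftʸ K G p)
  dominated = shift-dominated K G member

  -- `p` is the midpoint of its two opposite translates, so extremality identifies them; comparing
  -- x-coordinates then makes each `shift₀ (x p i)` vanish.
  p+≋p- : translate K G p (shiftˣ K G p) (shiftʸ K G p) ≋
          translate K G p (λ i → - shiftˣ K G p i) (λ e → - shiftʸ K G p e)
  p+≋p- = extreme
    (translate-feasible K G dominated)
    (translate-feasible K G (Dominated-neg K G dominated))
    0<½ ½<1
    (translate-midpoint K G (GVC-LP.z-def member))
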